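{- For every sequent $\Gamma\Rightarrow\alpha$ of the calculus $\mathsf{Gb}$: $\vdash_{\mathsf{Gb}}\Gamma\Rightarrow\alpha$ if and only if $\Gamma\Rightarrow\alpha$ is valid in the class of all bounded commutative bi-residuated lattice-ordered semigroups, i.e. $\mathsf{Gb}$ is sound and complete with respect to this class.
   Context: A bounded commutative bi-residuated lattice-ordered semigroup ($cb\mathcal{RL^- }$) is an algebra $(A,\wedge,\vee,\cdot,\backslash,\ast,\rightarrow,\bot,\top)$ such that $(A,\wedge,\vee)$ is a lattice with order $\le$, least element $\bot$, greatest element $\top$; $(A,\cdot)$ is a commutative semigroup with $a\cdot b\le c$ iff $b\le a\backslash c$; $\ast$ is a commutative (not necessarily associative) binary operation with $a\ast b\le c$ iff $b\le a\rightarrow c$; and if $(a\cdot b)\ast c=\bot$ then $(a\cdot c)\ast b=\bot$, for all $a,b,c$. Formulas of $\mathsf{Gb}$: variables $p$, the constant $\bot$, and $\alpha\cdot\beta$, $\alpha\backslash\beta$, $\alpha\wedge\beta$, $\alpha\vee\beta$, $\alpha\ast\beta$, $\alpha\rightarrow\beta$ ($\neg\alpha$ abbreviates $\alpha\rightarrow\bot$, $\top$ abbreviates $\neg\bot$). Formula structures: every formula is a structure, and if $\Gamma,\Delta$ are structures so are $(\Gamma,\Delta)$ and $(\Gamma;\Delta)$. A context $\Gamma[-]$ is a structure with one designated hole; $\Gamma[\Delta]$ is the result of filling it with $\Delta$. A sequent is $\Gamma\Rightarrow\alpha$ with $\Gamma$ a structure and $\alpha$ a formula. $f(\Gamma)$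 is the formula obtained from $\Gamma$ by replacing "," by $\cdot$ and ";" by $\ast$. A valuation $\mu$ into a $cb\mathcal{RL^- }$ maps variables to elements and extends homomorphically ($\mu(\bot)=\bot$); $\Gamma\Rightarrow\alpha$ is valid if $\mu(f(\Gamma))\le\mu(\alpha)$ for all $cb\mathcal{RL^- }$ and all valuations. Rules of $\mathsf{Gb}$ (premises / conclusion): $(\mathrm{Id})$ $\alpha\Rightarrow\alpha$; $(\cdot\mathrm{L})$ $\Gamma[\alpha,\beta]\Rightarrow\gamma$ / $\Gamma[\alpha\cdot\beta]\Rightarrow\gamma$; $(\cdot\mathrm{R})$ $\Gamma_1\Rightarrow\alpha$, $\Gamma_2\Rightarrow\beta$ / $\Gamma_1,\Gamma_2\Rightarrow\alpha\cdot\beta$; $(\ast\mathrm{L})$ $\Gamma[\alpha;\beta]\Rightarrow\gamma$ / $\Gamma[\alpha\ast\beta]\Rightarrow\gamma$; $(\ast\mathrm{R})$ $\Gamma_1\Rightarrow\alpha$, $\Gamma_2\Rightarrow\beta$ / $\Gamma_1;\Gamma_2\Rightarrow\alpha\ast\beta$; $(\backslash\mathrm{L})$ $\Delta\Rightarrow\alpha$, $\Gamma[\beta]\Rightarrow\gamma$ / $\Gamma[\Delta,\alpha\backslash\beta]\Rightarrow\gamma$; $(\backslash\mathrm{R})$ $\alpha,\Gamma\Rightarrow\beta$ / $\Gamma\Rightarrow\alpha\backslash\beta$; $(\rightarrow\mathrm{L})$ $\Delta\Rightarrow\alpha$, $\Gamma[\beta]\Rightarrow\gamma$ / $\Gamma[\Delta;\alpha\rightarrow\beta]\Rightarrow\gamma$;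 $(\rightarrow\mathrm{R})$ $\alpha;\Gamma\Rightarrow\beta$ / $\Gamma\Rightarrow\alpha\rightarrow\beta$; $(\wedge\mathrm{L})$ $\Gamma[\alpha]\Rightarrow\beta$ / $\Gamma[\alpha\wedge\gamma]\Rightarrow\beta$ and $\Gamma[\alpha]\Rightarrow\beta$ / $\Gamma[\gamma\wedge\alpha]\Rightarrow\beta$; $(\wedge\mathrm{R})$ $\Gamma\Rightarrow\alpha$, $\Gamma\Rightarrow\beta$ / $\Gamma\Rightarrow\alpha\wedge\beta$; $(\vee\mathrm{L})$ $\Gamma[\alpha]\Rightarrow\gamma$, $\Gamma[\beta]\Rightarrow\gamma$ / $\Gamma[\alpha\vee\beta]\Rightarrow\gamma$; $(\vee\mathrm{R})$ $\Gamma\Rightarrow\alpha$ / $\Gamma\Rightarrow\alpha\vee\beta$ and $\Gamma\Rightarrow\alpha$ / $\Gamma\Rightarrow\beta\vee\alpha$; $(\bot)$ $\Delta\Rightarrow\bot$ / $\Gamma[\Delta]\Rightarrow\alpha$; $(\mathrm{Cut})$ $\Delta\Rightarrow\alpha$, $\Gamma[\alpha]\Rightarrow\beta$ / $\Gamma[\Delta]\Rightarrow\beta$; $(\mathrm{R}\text{ - }\bot)$ $(\Delta_1,\Delta_2);\Delta_3\Rightarrow\bot$ / $(\Delta_1,\Delta_3);\Delta_2\Rightarrow\bot$; $(\mathrm{Ex})$ $\Gamma[\Delta_1,\Delta_2]\Rightarrow\beta$ / $\Gamma[\Delta_2,\Delta_1]\Rightarrow\beta$; $(\mathrm{Ex}^;)$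 $\Gamma[\Delta_1;\Delta_2]\Rightarrow\beta$ / $\Gamma[\Delta_2;\Delta_1]\Rightarrow\beta$; $(\mathrm{As}_1)$ $\Gamma[\Delta_1,(\Delta_2,\Delta_3)]\Rightarrow\beta$ / $\Gamma[(\Delta_1,\Delta_2),\Delta_3]\Rightarrow\beta$; $(\mathrm{As}_2)$ the converse of $(\mathrm{As}_1)$. -}

module Defs where

open import Level using (Level; suc; _⊔_)
open import Data.Nat using (ℕ)
open import Data.Product using (_×_; _,_)
open import Relation.Binary.PropositionalEquality using (_≡_)

data Fm : Set where
  var  : ℕ → Fm
  ⊥′   : Fm
  _·′_ : Fm → Fm → Fm
  _\′_ : Fm → Fm → Fm
  _∧′_ : Fm → Fm → Fm
  _∨′_ : Fm → Fm → Fm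
  _*′_ : Fm → Fm → Fm
  _⇒′_ : Fm → Fm → Fm

¬′_ : Fm → Fm
¬′ a = a ⇒′ ⊥′

⊤′ : Fm
⊤′ = ¬′ ⊥′

data Str : Set where
  fm   : Fm → Str
  _,,_ : Str → Str → Str
  _⨾_ : Str → Str → Str

data Ctx : Set where
  hole : Ctx
  _,ˡ_ : Ctx → Str → Ctx
  _,ʳ_ : Str → Ctx → Ctx
  _⨾ˡ_ : Ctx → Str → Ctx
  _⨾ʳ_ : Str → Ctx → Ctx

_[_] : Ctx → Str → Str
hole     [ D ] = D
(G ,ˡ S) [ D ] = (G [ D ]) ,, S
(S ,ʳ G) [ D ] = S ,, (G [ D ])
(G ⨾ˡ S) [ D ] = (G [ D ]) ⨾ S
(S ⨾ʳ G) [ D ] = S ⨾ (G [ D ])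

infix 4 _⊢_

data _⊢_ : Str → Fm → Set where
  Id   : ∀ {a} → fm a ⊢ a
  ·L   : ∀ {G a b c} → G [ fm a ,, fm b ] ⊢ c → G [ fm (a ·′ b) ] ⊢ c
  ·R   : ∀ {G₁ G₂ a b} → G₁ ⊢ a → G₂ ⊢ b → (G₁ ,, G₂) ⊢ a ·′ b
  *L   : ∀ {G a b c} → G [ fm a ⨾ fm b ] ⊢ c → G [ fm (a *′ b) ] ⊢ c
  *R   : ∀ {G₁ G₂ a b} → G₁ ⊢ a → G₂ ⊢ b → (G₁ ⨾ G₂) ⊢ a *′ b
  ＼L   : ∀ {D G a b c} → D ⊢ a → G [ fm b ] ⊢ c → G [ D ,, fm (a \′ b) ] ⊢ c
  ＼R   : ∀ {G a b} → (fm a ,, G) ⊢ b → G ⊢ a \′ b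
  ⇒L   : ∀ {D G a b c} → D ⊢ a → G [ fm b ] ⊢ c → G [ D ⨾ fm (a ⇒′ b) ] ⊢ c
  ⇒R   : ∀ {G a b} → (fm a ⨾ G) ⊢ b → G ⊢ a ⇒′ b
  ∧L₁  : ∀ {G a b c} → G [ fm a ] ⊢ b → G [ fm (a ∧′ c) ] ⊢ b
  ∧L₂  : ∀ {G a b c} → G [ fm a ] ⊢ b → G [ fm (c ∧′ a) ] ⊢ b
  ∧R   : ∀ {G a b} → G ⊢ a → G ⊢ b → G ⊢ a ∧′ b
  ∨L   : ∀ {G a b c} → G [ fm a ] ⊢ c → G [ fm b ] ⊢ c → G [ fm (a ∨′ b) ] ⊢ c
  ∨R₁  : ∀ {G a b} → G ⊢ a → G ⊢ a ∨′ b
  ∨R₂  : ∀ {G a b} → G ⊢ a → G ⊢ b ∨′ a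
  ⊥R   : ∀ {G D a} → D ⊢ ⊥′ → G [ D ] ⊢ a
  Cut  : ∀ {G D a b} → D ⊢ a → G [ fm a ] ⊢ b → G [ D ] ⊢ b
  R-⊥  : ∀ {D₁ D₂ D₃} → ((D₁ ,, D₂) ⨾ D₃) ⊢ ⊥′ → ((D₁ ,, D₃) ⨾ D₂) ⊢ ⊥′
  Ex   : ∀ {G D₁ D₂ b} → G [ D₁ ,, D₂ ] ⊢ b → G [ D₂ ,, D₁ ] ⊢ b
  Ex⨾  : ∀ {G D₁ D₂ b} → G [ D₁ ⨾ D₂ ] ⊢ b → G [ D₂ ⨾ D₁ ] ⊢ b
  As₁  : ∀ {G D₁ D₂ D₃ b} → G [ D₁ ,, (D₂ ,, D₃) ] ⊢ b → G [ (D₁ ,, D₂) ,, D₃ ] ⊢ b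
  As₂  : ∀ {G D₁ D₂ D₃ b} → G [ (D₁ ,, D₂) ,, D₃ ] ⊢ b → G [ D₁ ,, (D₂ ,, D₃) ] ⊢ b

record CbRL (ℓ : Level) : Set (suc ℓ) where
  infixr 7 _·_ _*_
  infixr 6 _∧_
  infixr 5 _∨_
  infix 4 _≤_
  field
    Carrier : Set ℓ
    _∧_ _∨_ _·_ _\\_ _*_ _⇒_ : Carrier → Carrier → Carrier
    bot top : Carrier

  _≤_ : Carrier → Carrier → Set ℓ
  a ≤ b = a ∧ b ≡ a

  field
    ∧-assoc  : ∀ a b c → (a ∧ b) ∧ c ≡ a ∧ (b ∧ c)
    ∨-assoc  : ∀ a b c → (a ∨ b) ∨ c ≡ a ∨ (b ∨ c)
    ∧-comm   : ∀ a b → a ∧ b ≡ b ∧ a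
    ∨-comm   : ∀ a b → a ∨ b ≡ b ∨ a
    ∧-absorb : ∀ a b → a ∧ (a ∨ b) ≡ a
    ∨-absorb : ∀ a b → a ∨ (a ∧ b) ≡ a
    bot-least : ∀ a → bot ≤ a
    top-great : ∀ a → a ≤ top
    ·-assoc  : ∀ a b c → (a · b) · c ≡ a · (b · c)
    ·-comm   : ∀ a b → a · b ≡ b · a
    ·-res₁   : ∀ a b c → a · b ≤ c → b ≤ a \\ c
    ·-res₂   : ∀ a b c → b ≤ a \\ c → a · b ≤ c
    *-comm   : ∀ a b → a * b ≡ b * a
    *-res₁   : ∀ a b c → a * b ≤ c → b ≤ a ⇒ c
    *-res₂   : ∀ a b c → b ≤ a ⇒ c → a * b ≤ c
    ⊥-cond   : ∀ a b c → (a · b) * c ≡ bot → (a · c) * b ≡ bot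

module _ {ℓ : Level} (A : CbRL ℓ) where
  open CbRL A

  ⟦_⟧ : (ℕ → Carrier) → Fm → Carrier
  ⟦ μ ⟧ (var p)  = μ p
  ⟦ μ ⟧ ⊥′       = bot
  ⟦ μ ⟧ (a ·′ b) = ⟦ μ ⟧ a · ⟦ μ ⟧ b
  ⟦ μ ⟧ (a \′ b) = ⟦ μ ⟧ a \\ ⟦ μ ⟧ b
  ⟦ μ ⟧ (a ∧′ b) = ⟦ μ ⟧ a ∧ ⟦ μ ⟧ b
  ⟦ μ ⟧ (a ∨′ b) = ⟦ μ ⟧ a ∨ ⟦ μ ⟧ b
  ⟦ μ ⟧ (a *′ b) = ⟦ μ ⟧ a * ⟦ μ ⟧ b
  ⟦ μ ⟧ (a ⇒′ b) = ⟦ μ ⟧ a ⇒ ⟦ μ ⟧ b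

f : Str → Fm
f (fm a)   = a
f (G ,, D) = f G ·′ f D
f (G ⨾ D) = f G *′ f D

Valid : (ℓ : Level) → Str → Fm → Set (suc ℓ)
Valid ℓ G a = (A : CbRL ℓ) (μ : ℕ → CbRL.Carrier A) →
  CbRL._≤_ A (⟦ A ⟧ μ (f G)) (⟦ A ⟧ μ a)

{-# OPTIONS --safe #-}
module Submission where

-- Algebras satisfy their laws up to propositional equality and there are no
-- quotients, so the Lindenbaum algebra needs canonical representatives of
-- interderivable formulas, and for this derivability has to be decidable.
-- Cut is eliminated semantically: formulas are read as sets of structures that
-- are closed under the Galois connection x ↦ {(C, c) | C [ x ] ⊢ c} of cut-free
-- derivability; a ∈ ⟦a⟧ ⊆ {x | x ⊢ a without cut}, and all rules, including
-- Cut, are sound for this reading.  In the cut-free rules no premise is larger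
-- than the conclusion, so saturating the finite set of sequents of bounded size
-- decides derivability.  The representative of a formula is then the first
-- formula equivalent to it in a fixed enumeration.

open import Defs
open import Level using (Level; 0ℓ)
open import Algebra.Lattice.Bundles using () renaming (Lattice to AlgebraicLattice)
import Algebra.Lattice.Properties.Lattice as AlgebraicLatticeProperties
open import Axiom.UniquenessOfIdentityProofs.WithK using (uip)
open import Data.Empty using (⊥)
open import Data.List using (List; []; _∷_; _++_; map; concatMap; length; cartesianProductWith; cartesianProduct)
open import Data.List.Properties using (++-assoc; ++-identityʳ; length-removeAt′)
import Data.List.Membership.DecPropositional as DecMembership
open import Data.List.Membership.Propositional using (_∈_; find; lose)
open import Data.List.Membership.Propositional.Properties using (∈-++⁺ˡ; ∈-++⁺ʳ; ∈-map⁺; ∈-concatMap⁺; ∈-cartesianProductWith⁺; ∈-cartesianProduct⁺)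
open import Data.List.Relation.Unary.All as All using (All; []; _∷_; all?)
open import Data.List.Relation.Unary.Any as Any using (Any; here; there; any?; _─_)
open import Data.List.Relation.Unary.Any.Properties using (lookup-result)
open import Data.Nat using (ℕ; zero; suc; _+_; _≤_; _≤′_; z≤n; s≤s; ≤′-refl; ≤′-step)
import Data.Nat.Properties as ℕ
open import Data.Nat.Solver using (module +-*-Solver)
open import Data.Product using (Σ-syntax; ∃-syntax; _×_; _,_; proj₁; proj₂; uncurry)
import Data.Product.Properties as Product
open import Data.Sum as Sum using (_⊎_; inj₁; inj₂; [_,_]′)
open import Function.Base using (_∘_)
open import Function.Bundles using (_⇔_; mk⇔)
open import Relation.Binary.Definitions using (DecidableEquality)
open import Relation.Binary.Lattice using (Lattice)
import Relation.Binary.Lattice.Properties.JoinSemilattice as JoinProperties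
import Relation.Binary.Lattice.Properties.MeetSemilattice as MeetProperties
import Relation.Binary.Lattice.Properties.Lattice as LatticeProperties
open import Relation.Binary.PropositionalEquality using (_≡_; refl; sym; trans; cong; cong₂; subst; subst₂; isEquivalence)
open import Relation.Nullary using (Dec; yes; no; contradiction)
open import Relation.Nullary.Decidable using (map′; _×-dec_)
open import Relation.Unary using (Pred; Decidable; _⊆_; _∪_)

-- Soundness

module Soundness {ℓ : Level} (A : CbRL ℓ) (μ : ℕ → CbRL.Carrier A) where
  open CbRL A renaming (_≤_ to _⊑_)

  private
    algebraicLattice : AlgebraicLattice ℓ ℓ
    algebraicLattice = record
      { _≈_ = _≡_ ; _∨_ = _∨_ ; _∧_ = _∧_
      ; isLattice = record
        { isEquivalence = isEquivalence
        ; ∨-comm = ∨-comm ; ∨-assoc = ∨-assoc ; ∨-cong = cong₂ _∨_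
        ; ∧-comm = ∧-comm ; ∧-assoc = ∧-assoc ; ∧-cong = cong₂ _∧_
        ; absorptive = ∨-absorb , ∧-absorb
        }
      }

    -- The library orders an algebraic lattice by x ≡ x ∧ y, the mirror image of _⊑_.
    module L = Lattice (AlgebraicLatticeProperties.∨-∧-orderTheoreticLattice algebraicLattice)

  ⊑-reflexive : ∀ {x y} → x ≡ y → x ⊑ y
  ⊑-reflexive x≡y = sym (L.reflexive x≡y)

  ⊑-refl : ∀ {x} → x ⊑ x
  ⊑-refl = ⊑-reflexive refl

  ⊑-trans : ∀ {x y z} → x ⊑ y → y ⊑ z → x ⊑ z
  ⊑-trans x⊑y y⊑z = sym (L.trans (sym x⊑y) (sym y⊑z))

  ⊑-bot : ∀ {x} → x ⊑ bot → x ≡ bot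
  ⊑-bot x⊑⊥ = L.antisym (sym x⊑⊥) (sym (bot-least _))

  ·-monoʳ : ∀ {x y} z → x ⊑ y → z · x ⊑ z · y
  ·-monoʳ z x⊑y = ·-res₂ _ _ _ (⊑-trans x⊑y (·-res₁ _ _ _ ⊑-refl))

  ·-mono : ∀ {x y u v} → x ⊑ y → u ⊑ v → x · u ⊑ y · v
  ·-mono {x} {y} {u} {v} x⊑y u⊑v = ⊑-trans (·-monoʳ x u⊑v)
    (⊑-trans (⊑-reflexive (·-comm x v)) (⊑-trans (·-monoʳ v x⊑y) (⊑-reflexive (·-comm v y))))

  *-monoʳ : ∀ {x y} z → x ⊑ y → z * x ⊑ z * y
  *-monoʳ z x⊑y = *-res₂ _ _ _ (⊑-trans x⊑y (*-res₁ _ _ _ ⊑-refl))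

  *-mono : ∀ {x y u v} → x ⊑ y → u ⊑ v → x * u ⊑ y * v
  *-mono {x} {y} {u} {v} x⊑y u⊑v = ⊑-trans (*-monoʳ x u⊑v)
    (⊑-trans (⊑-reflexive (*-comm x v)) (⊑-trans (*-monoʳ v x⊑y) (⊑-reflexive (*-comm v y))))

  value : Fm → Carrier
  value = ⟦ A ⟧ μ

  ⟦_⟧ˢ : Str → Carrier
  ⟦ D ⟧ˢ = value (f D)

  -- The right adjoint of filling `C`, built by peeling layers from the outside. Holes on the left
  -- and on the right share one residual because both products are commutative.
  residual : Ctx → Carrier → Carrier
  residual hole     c = c
  residual (C ,ˡ S) c = residual C (⟦ S ⟧ˢ \\ c)
  residual (S ,ʳ C) c = residual C (⟦ S ⟧ˢ \\ c)
  residual (C ⨾ˡ S) c = residual C (⟦ S ⟧ˢ ⇒ c)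
  residual (S ⨾ʳ C) c = residual C (⟦ S ⟧ˢ ⇒ c)

  -- With `unresiduate` this is an adjunction, so filling a context is monotone and preserves joins
  -- and `bot`. That handles every rule acting deep inside a structure.
  residuate : ∀ C {D c} → ⟦ C [ D ] ⟧ˢ ⊑ c → ⟦ D ⟧ˢ ⊑ residual C c
  residuate hole     p = p
  residuate (C ,ˡ S) p = residuate C (·-res₁ _ _ _ (⊑-trans (⊑-reflexive (·-comm _ _)) p))
  residuate (S ,ʳ C) p = residuate C (·-res₁ _ _ _ p)
  residuate (C ⨾ˡ S) p = residuate C (*-res₁ _ _ _ (⊑-trans (⊑-reflexive (*-comm _ _)) p))
  residuate (S ⨾ʳ C) p = residuate C (*-res₁ _ _ _ p)

  unresiduate : ∀ C {D c} → ⟦ D ⟧ˢ ⊑ residual C c → ⟦ C [ D ] ⟧ˢ ⊑ c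
  unresiduate hole     p = p
  unresiduate (C ,ˡ S) p = ⊑-trans (⊑-reflexive (·-comm _ _)) (·-res₂ _ _ _ (unresiduate C p))
  unresiduate (S ,ʳ C) p = ·-res₂ _ _ _ (unresiduate C p)
  unresiduate (C ⨾ˡ S) p = ⊑-trans (⊑-reflexive (*-comm _ _)) (*-res₂ _ _ _ (unresiduate C p))
  unresiduate (S ⨾ʳ C) p = *-res₂ _ _ _ (unresiduate C p)

  replace : ∀ C {D E c} → ⟦ D ⟧ˢ ⊑ ⟦ E ⟧ˢ → ⟦ C [ E ] ⟧ˢ ⊑ c → ⟦ C [ D ] ⟧ˢ ⊑ c
  replace C D⊑E p = unresiduate C (⊑-trans D⊑E (residuate C p))

  sound : ∀ {G a} → G ⊢ a → ⟦ G ⟧ˢ ⊑ value a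
  sound Id = ⊑-refl
  sound (·L {C} p) = replace C {E = _ ,, _} ⊑-refl (sound p)
  sound (·R p q) = ·-mono (sound p) (sound q)
  sound (*L {C} p) = replace C {E = _ ⨾ _} ⊑-refl (sound p)
  sound (*R p q) = *-mono (sound p) (sound q)
  sound (＼L {D} {C} {a} {b} p q) = replace C {D ,, fm (a \′ b)}
    (⊑-trans (·-mono (sound p) ⊑-refl) (·-res₂ _ _ _ ⊑-refl)) (sound q)
  sound (＼R p) = ·-res₁ _ _ _ (sound p)
  sound (⇒L {D} {C} {a} {b} p q) = replace C {D ⨾ fm (a ⇒′ b)}
    (⊑-trans (*-mono (sound p) ⊑-refl) (*-res₂ _ _ _ ⊑-refl)) (sound q)
  sound (⇒R p) = *-res₁ _ _ _ (sound p)
  sound (∧L₁ {C} p) = replace C (sym (L.x∧y≤x _ _)) (sound p)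
  sound (∧L₂ {C} p) = replace C (sym (L.x∧y≤y _ _)) (sound p)
  sound (∧R p q) = sym (L.∧-greatest (sym (sound p)) (sym (sound q)))
  -- Both premises bound a disjunct by the same residual, which therefore bounds the join.
  sound (∨L {C} {a} {b} p q) = unresiduate C {fm (a ∨′ b)}
    (sym (L.∨-least (sym (residuate C (sound p))) (sym (residuate C (sound q)))))
  sound (∨R₁ p) = ⊑-trans (sound p) (sym (L.x≤x∨y _ _))
  sound (∨R₂ p) = ⊑-trans (sound p) (sym (L.y≤x∨y _ _))
  sound (⊥R {C} p) = unresiduate C (⊑-trans (sound p) (bot-least _))
  sound (Cut {C} p q) = replace C (sound p) (sound q)
  -- The algebraic condition speaks of equality with `bot`, so the inequality is first sharpened to
  -- an equation.
  sound (R-⊥ p) = ⊑-reflexive (⊥-cond _ _ _ (⊑-bot (sound p)))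
  sound (Ex {C} {D} {E} p) = replace C {E ,, D} (⊑-reflexive (·-comm _ _)) (sound p)
  sound (Ex⨾ {C} {D} {E} p) = replace C {E ⨾ D} (⊑-reflexive (*-comm _ _)) (sound p)
  sound (As₁ {C} {D₁} {D₂} {D₃} p) =
    replace C {(D₁ ,, D₂) ,, D₃} (⊑-reflexive (·-assoc _ _ _)) (sound p)
  sound (As₂ {C} {D₁} {D₂} {D₃} p) =
    replace C {D₁ ,, (D₂ ,, D₃)} (⊑-reflexive (sym (·-assoc _ _ _))) (sound p)

-- Decidable equality of formulas and structures

-- Comparing formulas directly would take a case for each pair of constructors. Labelled trees need
-- four cases, and the left inverse `decode` transfers the decision back.
data Tree : Set where
  leaf : ℕ → Tree
  node : ℕ → Tree → Tree → Tree

infix 4 _≟ᵗ_ _≟_ _≟ˢ_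

_≟ᵗ_ : DecidableEquality Tree
leaf m ≟ᵗ leaf n = map′ (cong leaf) (λ { refl → refl }) (m ℕ.≟ n)
leaf _ ≟ᵗ node _ _ _ = no λ ()
node _ _ _ ≟ᵗ leaf _ = no λ ()
node m s t ≟ᵗ node n u v =
  map′ (λ { (refl , refl , refl) → refl }) (λ { refl → refl , refl , refl })
    (m ℕ.≟ n ×-dec s ≟ᵗ u ×-dec t ≟ᵗ v)

encode : Fm → Tree
encode (var p)  = leaf (suc p)
encode ⊥′       = leaf 0
encode (a ·′ b) = node 0 (encode a) (encode b)
encode (a \′ b) = node 1 (encode a) (encode b)
encode (a ∧′ b) = node 2 (encode a) (encode b)
encode (a ∨′ b) = node 3 (encode a) (encode b)
encode (a *′ b) = node 4 (encode a) (encode b)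
encode (a ⇒′ b) = node 5 (encode a) (encode b)

decode : Tree → Fm
decode (leaf zero)    = ⊥′
decode (leaf (suc p)) = var p
decode (node 0 s t)   = decode s ·′ decode t
decode (node 1 s t)   = decode s \′ decode t
decode (node 2 s t)   = decode s ∧′ decode t
decode (node 3 s t)   = decode s ∨′ decode t
decode (node 4 s t)   = decode s *′ decode t
decode (node _ s t)   = decode s ⇒′ decode t

decode-encode : ∀ a → decode (encode a) ≡ a
decode-encode (var p)  = refl
decode-encode ⊥′       = refl
decode-encode (a ·′ b) = cong₂ _·′_ (decode-encode a) (decode-encode b)
decode-encode (a \′ b) = cong₂ _\′_ (decode-encode a) (decode-encode b)
decode-encode (a ∧′ b) = cong₂ _∧′_ (decode-encode a) (decode-encode b)
decode-encode (a ∨′ b) = cong₂ _∨′_ (decode-encode a) (decode-encode b)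
decode-encode (a *′ b) = cong₂ _*′_ (decode-encode a) (decode-encode b)
decode-encode (a ⇒′ b) = cong₂ _⇒′_ (decode-encode a) (decode-encode b)

_≟_ : DecidableEquality Fm
a ≟ b = map′
  (λ eq → trans (sym (decode-encode a)) (trans (cong decode eq) (decode-encode b)))
  (cong encode) (encode a ≟ᵗ encode b)

_≟ˢ_ : DecidableEquality Str
fm a ≟ˢ fm b = map′ (cong fm) (λ { refl → refl }) (a ≟ b)
(G ,, D) ≟ˢ (H ,, E) = map′ (λ { (refl , refl) → refl }) (λ { refl → refl , refl }) (G ≟ˢ H ×-dec D ≟ˢ E)
(G ⨾ D) ≟ˢ (H ⨾ E) = map′ (λ { (refl , refl) → refl }) (λ { refl → refl , refl }) (G ≟ˢ H ×-dec D ≟ˢ E)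
fm _ ≟ˢ (_ ,, _) = no λ ()
fm _ ≟ˢ (_ ⨾ _) = no λ ()
(_ ,, _) ≟ˢ fm _ = no λ ()
(_ ,, _) ≟ˢ (_ ⨾ _) = no λ ()
(_ ⨾ _) ≟ˢ fm _ = no λ ()
(_ ⨾ _) ≟ˢ (_ ,, _) = no λ ()

-- Cut-free rule instances

Seq : Set
Seq = Str × Fm

Provable : Pred Seq 0ℓ
Provable = uncurry _⊢_

-- A variable weighs more than its index, so only finitely many formulas have a given size.
∣_∣ : Fm → ℕ
∣ var p ∣  = suc p
∣ ⊥′ ∣     = 1
∣ a ·′ b ∣ = suc (∣ a ∣ + ∣ b ∣)
∣ a \′ b ∣ = suc (∣ a ∣ + ∣ b ∣)
∣ a ∧′ b ∣ = suc (∣ a ∣ + ∣ b ∣)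
∣ a ∨′ b ∣ = suc (∣ a ∣ + ∣ b ∣)
∣ a *′ b ∣ = suc (∣ a ∣ + ∣ b ∣)
∣ a ⇒′ b ∣ = suc (∣ a ∣ + ∣ b ∣)

∣_∣ˢ : Str → ℕ
∣ fm a ∣ˢ   = ∣ a ∣
∣ G ,, D ∣ˢ = suc (∣ G ∣ˢ + ∣ D ∣ˢ)
∣ G ⨾ D ∣ˢ  = suc (∣ G ∣ˢ + ∣ D ∣ˢ)

size : Seq → ℕ
size (G , a) = ∣ G ∣ˢ + ∣ a ∣

-- Keeps `explosion` within the size bound: its premise has succedent `⊥′`, of the least possible
-- size 1.
1≤∣_∣ : ∀ a → 1 ≤ ∣ a ∣
1≤∣ var p ∣  = s≤s z≤n
1≤∣ ⊥′ ∣     = s≤s z≤n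
1≤∣ a ·′ b ∣ = s≤s z≤n
1≤∣ a \′ b ∣ = s≤s z≤n
1≤∣ a ∧′ b ∣ = s≤s z≤n
1≤∣ a ∨′ b ∣ = s≤s z≤n
1≤∣ a *′ b ∣ = s≤s z≤n
1≤∣ a ⇒′ b ∣ = s≤s z≤n

plug-mono : ∀ C {D E} → ∣ D ∣ˢ ≤ ∣ E ∣ˢ → ∣ C [ D ] ∣ˢ ≤ ∣ C [ E ] ∣ˢ
plug-mono hole     h = h
plug-mono (C ,ˡ S) h = s≤s (ℕ.+-monoˡ-≤ _ (plug-mono C h))
plug-mono (S ,ʳ C) h = s≤s (ℕ.+-monoʳ-≤ ∣ S ∣ˢ (plug-mono C h))
plug-mono (C ⨾ˡ S) h = s≤s (ℕ.+-monoˡ-≤ _ (plug-mono C h))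
plug-mono (S ⨾ʳ C) h = s≤s (ℕ.+-monoʳ-≤ ∣ S ∣ˢ (plug-mono C h))

plug-inflationary : ∀ C D → ∣ D ∣ˢ ≤ ∣ C [ D ] ∣ˢ
plug-inflationary hole     D = ℕ.≤-refl
plug-inflationary (C ,ˡ S) D = ℕ.m≤n⇒m≤1+n (ℕ.m≤n⇒m≤n+o _ (plug-inflationary C D))
plug-inflationary (S ,ʳ C) D = ℕ.m≤n⇒m≤1+n (ℕ.m≤n⇒m≤o+n ∣ S ∣ˢ (plug-inflationary C D))
plug-inflationary (C ⨾ˡ S) D = ℕ.m≤n⇒m≤1+n (ℕ.m≤n⇒m≤n+o _ (plug-inflationary C D))
plug-inflationary (S ⨾ʳ C) D = ℕ.m≤n⇒m≤1+n (ℕ.m≤n⇒m≤o+n ∣ S ∣ˢ (plug-inflationary C D))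

-- Soundness and the size bound travel with each instance, so later inductions on derivations need
-- no case analysis over the rules.
record Rule (s : Seq) : Set where
  constructor rule
  field
    premises      : List Seq
    correct       : All Provable premises → Provable s
    nonincreasing : All (λ t → size t ≤ size s) premises

open Rule

-- Matching on a focus refines the index to `C [ D ]`, so no equation between structures has to be
-- transported.
data Focus : Str → Set where
  _at_ : ∀ C D → Focus (C [ D ])

focus-,ˡ : ∀ D {G} → Focus G → Focus (G ,, D)
focus-,ˡ D (C at E) = (C ,ˡ D) at E

focus-,ʳ : ∀ G {D} → Focus D → Focus (G ,, D)
focus-,ʳ G (C at E) = (G ,ʳ C) at E

focus-⨾ˡ : ∀ D {G} → Focus G → Focus (G ⨾ D)
focus-⨾ˡ D (C at E) = (C ⨾ˡ D) at E

focus-⨾ʳ : ∀ G {D} → Focus D → Focus (G ⨾ D)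
focus-⨾ʳ G (C at E) = (G ⨾ʳ C) at E

mutual
  foci : ∀ G → List (Focus G)
  foci G = (hole at G) ∷ properFoci G

  -- Kept apart from `foci` so that the trivial focus heads the list before the shape of `G` is
  -- known.
  properFoci : ∀ G → List (Focus G)
  properFoci (fm a)   = []
  properFoci (G ,, D) = map (focus-,ˡ D) (foci G) ++ map (focus-,ʳ G) (foci D)
  properFoci (G ⨾ D)  = map (focus-⨾ˡ D) (foci G) ++ map (focus-⨾ʳ G) (foci D)

foci-complete : ∀ C D → (C at D) ∈ foci (C [ D ])
foci-complete hole     D = here refl
foci-complete (C ,ˡ S) D = there (∈-++⁺ˡ (∈-map⁺ (focus-,ˡ S) (foci-complete C D)))
foci-complete (S ,ʳ C) D = there
  (∈-++⁺ʳ (map (focus-,ˡ (C [ D ])) (foci S)) (∈-map⁺ (focus-,ʳ S) (foci-complete C D)))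
foci-complete (C ⨾ˡ S) D = there (∈-++⁺ˡ (∈-map⁺ (focus-⨾ˡ S) (foci-complete C D)))
foci-complete (S ⨾ʳ C) D = there
  (∈-++⁺ʳ (map (focus-⨾ˡ (C [ D ])) (foci S)) (∈-map⁺ (focus-⨾ʳ S) (foci-complete C D)))

rewriteAt : ∀ C {D E c} → ∣ E ∣ˢ ≤ ∣ D ∣ˢ → (C [ E ] ⊢ c → C [ D ] ⊢ c) → Rule (C [ D ] , c)
rewriteAt C {D} {E} {c} E≤D r = rule ((C [ E ] , c) ∷ [])
  (λ { (p ∷ []) → r p }) (ℕ.+-monoˡ-≤ _ (plug-mono C E≤D) ∷ [])

explosion : ∀ C D c → List (Rule (C [ D ] , c))
explosion C D c = rule ((D , ⊥′) ∷ []) (λ { (p ∷ []) → ⊥R {C} p })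
  (ℕ.+-mono-≤ (plug-inflationary C D) 1≤∣ c ∣ ∷ []) ∷ []

-- The equation leaves open which structural connective and which implication form `E`, so one bound
-- serves both left implication rules.
implication-size : ∀ C (D : Str) {E} a b c → suc (∣ D ∣ˢ + suc (∣ a ∣ + ∣ b ∣)) ≡ ∣ E ∣ˢ →
  All (λ t → size t ≤ size (C [ E ] , c)) ((D , a) ∷ (C [ fm b ] , c) ∷ [])
implication-size C D {E} a b c eq =
  ℕ.m≤n⇒m≤n+o _ (ℕ.≤-trans D+a≤E (plug-inflationary C E)) ∷
  ℕ.+-monoˡ-≤ _ (plug-mono C b≤E) ∷ []
  where
  D+a≤E : ∣ D ∣ˢ + ∣ a ∣ ≤ ∣ E ∣ˢ
  D+a≤E = subst (∣ D ∣ˢ + ∣ a ∣ ≤_) eq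
    (ℕ.m≤n⇒m≤1+n (ℕ.+-monoʳ-≤ ∣ D ∣ˢ (ℕ.m≤n⇒m≤1+n (ℕ.m≤m+n _ _))))
  b≤E : ∣ b ∣ ≤ ∣ E ∣ˢ
  b≤E = subst (∣ b ∣ ≤_) eq
    (ℕ.m≤n⇒m≤1+n (ℕ.m≤n⇒m≤o+n ∣ D ∣ˢ (ℕ.m≤n⇒m≤1+n (ℕ.m≤n+m _ _))))

leftLogical : ∀ C D c → List (Rule (C [ D ] , c))
leftLogical C (fm (a ·′ b)) c = rewriteAt C {E = fm a ,, fm b} ℕ.≤-refl (·L {C}) ∷ []
leftLogical C (fm (a *′ b)) c = rewriteAt C {E = fm a ⨾ fm b} ℕ.≤-refl (*L {C}) ∷ []
leftLogical C (fm (a ∧′ b)) c =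
  rewriteAt C {E = fm a} (ℕ.m≤n⇒m≤1+n (ℕ.m≤m+n _ _)) (∧L₁ {C}) ∷
  rewriteAt C {E = fm b} (ℕ.m≤n⇒m≤1+n (ℕ.m≤n+m _ _)) (∧L₂ {C}) ∷ []
leftLogical C (fm (a ∨′ b)) c =
  rule ((C [ fm a ] , c) ∷ (C [ fm b ] , c) ∷ []) (λ { (p ∷ q ∷ []) → ∨L {C} p q })
    (ℕ.+-monoˡ-≤ _ (plug-mono C (ℕ.m≤n⇒m≤1+n (ℕ.m≤m+n _ _))) ∷
     ℕ.+-monoˡ-≤ _ (plug-mono C (ℕ.m≤n⇒m≤1+n (ℕ.m≤n+m _ _))) ∷ []) ∷ []
leftLogical C (D ,, fm (a \′ b)) c =
  rule _ (λ { (p ∷ q ∷ []) → ＼L {G = C} p q }) (implication-size C D a b c refl) ∷ []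
leftLogical C (D ⨾ fm (a ⇒′ b)) c =
  rule _ (λ { (p ∷ q ∷ []) → ⇒L {G = C} p q }) (implication-size C D a b c refl) ∷ []
leftLogical _ _ _ = []

exchange : ∀ C D c → List (Rule (C [ D ] , c))
exchange C (D ,, E) c = rewriteAt C (s≤s (ℕ.≤-reflexive (ℕ.+-comm ∣ E ∣ˢ _))) (Ex {C}) ∷ []
exchange C (D ⨾ E)  c = rewriteAt C (s≤s (ℕ.≤-reflexive (ℕ.+-comm ∣ E ∣ˢ _))) (Ex⨾ {C}) ∷ []
exchange _ _ _ = []

assoc-size : ∀ m n o → suc (m + suc (n + o)) ≡ suc (suc (m + n) + o)
assoc-size = solve 3 (λ m n o →
  con 1 :+ (m :+ (con 1 :+ (n :+ o))) := con 1 :+ ((con 1 :+ (m :+ n)) :+ o)) refl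
  where open +-*-Solver

associate₁ : ∀ C D c → List (Rule (C [ D ] , c))
associate₁ C ((D₁ ,, D₂) ,, D₃) c = rewriteAt C {E = D₁ ,, (D₂ ,, D₃)}
  (ℕ.≤-reflexive (assoc-size (∣ D₁ ∣ˢ) (∣ D₂ ∣ˢ) (∣ D₃ ∣ˢ))) (As₁ {C}) ∷ []
associate₁ _ _ _ = []

associate₂ : ∀ C D c → List (Rule (C [ D ] , c))
associate₂ C (D₁ ,, (D₂ ,, D₃)) c = rewriteAt C {E = (D₁ ,, D₂) ,, D₃}
  (ℕ.≤-reflexive (sym (assoc-size (∣ D₁ ∣ˢ) (∣ D₂ ∣ˢ) (∣ D₃ ∣ˢ)))) (As₂ {C}) ∷ []
associate₂ _ _ _ = []

leftRules : ∀ c {G} → Focus G → List (Rule (G , c))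
leftRules c (C at D) =
  explosion C D c ++ leftLogical C D c ++ exchange C D c ++ associate₁ C D c ++ associate₂ C D c

product-size : ∀ G D a b →
  All (λ t → size t ≤ suc (∣ G ∣ˢ + ∣ D ∣ˢ) + suc (∣ a ∣ + ∣ b ∣)) ((G , a) ∷ (D , b) ∷ [])
product-size G D a b =
  ℕ.+-mono-≤ (ℕ.m≤n⇒m≤1+n (ℕ.m≤m+n ∣ G ∣ˢ _)) (ℕ.m≤n⇒m≤1+n (ℕ.m≤m+n ∣ a ∣ _)) ∷
  ℕ.+-mono-≤ (ℕ.m≤n⇒m≤1+n (ℕ.m≤n+m _ ∣ G ∣ˢ)) (ℕ.m≤n⇒m≤1+n (ℕ.m≤n+m _ ∣ a ∣)) ∷ []

-- Read upwards, a right implication rule trades a logical connective for a structural one. The size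
-- stays the same, which is why premises are only required not to grow.
residual-size : ∀ m n o → suc (m + n) + o ≡ n + suc (m + o)
residual-size = solve 3 (λ m n o →
  (con 1 :+ (m :+ n)) :+ o := n :+ (con 1 :+ (m :+ o))) refl
  where open +-*-Solver

rightLogical : ∀ c G → List (Rule (G , c))
rightLogical (a ·′ b) (G ,, D) =
  rule ((G , a) ∷ (D , b) ∷ []) (λ { (p ∷ q ∷ []) → ·R p q }) (product-size G D a b) ∷ []
rightLogical (a *′ b) (G ⨾ D) =
  rule ((G , a) ∷ (D , b) ∷ []) (λ { (p ∷ q ∷ []) → *R p q }) (product-size G D a b) ∷ []
rightLogical (a \′ b) G =
  rule ((fm a ,, G , b) ∷ []) (λ { (p ∷ []) → ＼R p }) (ℕ.≤-reflexive (residual-size (∣ a ∣) (∣ G ∣ˢ) (∣ b ∣)) ∷ []) ∷ []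
rightLogical (a ⇒′ b) G =
  rule ((fm a ⨾ G , b) ∷ []) (λ { (p ∷ []) → ⇒R p }) (ℕ.≤-reflexive (residual-size (∣ a ∣) (∣ G ∣ˢ) (∣ b ∣)) ∷ []) ∷ []
rightLogical (a ∧′ b) G =
  rule ((G , a) ∷ (G , b) ∷ []) (λ { (p ∷ q ∷ []) → ∧R p q })
    (ℕ.+-monoʳ-≤ ∣ G ∣ˢ (ℕ.m≤n⇒m≤1+n (ℕ.m≤m+n _ _)) ∷
     ℕ.+-monoʳ-≤ ∣ G ∣ˢ (ℕ.m≤n⇒m≤1+n (ℕ.m≤n+m _ _)) ∷ []) ∷ []
rightLogical (a ∨′ b) G =
  rule ((G , a) ∷ []) (λ { (p ∷ []) → ∨R₁ p }) (ℕ.+-monoʳ-≤ ∣ G ∣ˢ (ℕ.m≤n⇒m≤1+n (ℕ.m≤m+n _ _)) ∷ []) ∷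
  rule ((G , b) ∷ []) (λ { (p ∷ []) → ∨R₂ p }) (ℕ.+-monoʳ-≤ ∣ G ∣ˢ (ℕ.m≤n⇒m≤1+n (ℕ.m≤n+m _ _)) ∷ []) ∷ []
rightLogical _ _ = []

rotation-size : ∀ m n o → suc (suc (m + n) + o) + 1 ≡ suc (suc (m + o) + n) + 1
-- The trailing 1 is the size of the succedent `⊥′`.
rotation-size = solve 3 (λ m n o →
  (con 1 :+ ((con 1 :+ (m :+ n)) :+ o)) :+ con 1 := (con 1 :+ ((con 1 :+ (m :+ o)) :+ n)) :+ con 1) refl
  where open +-*-Solver

rotation : ∀ c G → List (Rule (G , c))
rotation ⊥′ ((D₁ ,, D₃) ⨾ D₂) =
  rule (((D₁ ,, D₂) ⨾ D₃ , ⊥′) ∷ []) (λ { (p ∷ []) → R-⊥ p })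
    (ℕ.≤-reflexive (rotation-size (∣ D₁ ∣ˢ) (∣ D₂ ∣ˢ) (∣ D₃ ∣ˢ)) ∷ []) ∷ []
rotation _ _ = []

identity : ∀ c G → List (Rule (G , c))
identity c (fm a) with a ≟ c
... | yes refl = rule [] (λ { [] → Id }) [] ∷ []
... | no _     = []
identity _ _ = []

rules : ∀ s → List (Rule s)
rules (G , c) = concatMap (leftRules c) (foci G) ++ rightLogical c G ++ rotation c G ++ identity c G

-- Inferences are drawn from the finite list `rules s`, which a search can run through.
data Der : Seq → Set where
  infer : ∀ {s} (r : Rule s) → r ∈ rules s → All Der (premises r) → Der s

infix 4 _⊢ᶜ_

_⊢ᶜ_ : Str → Fm → Set
G ⊢ᶜ a = Der (G , a)

mutual
  Der⇒Provable : ∀ {s} → Der s → Provable s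
  Der⇒Provable (infer r _ ds) = correct r (Ders⇒Provable ds)

  Ders⇒Provable : ∀ {ss} → All Der ss → All Provable ss
  Ders⇒Provable []       = []
  Ders⇒Provable (d ∷ ds) = Der⇒Provable d ∷ Ders⇒Provable ds

-- Cut-free derivations built from the listed instances

module _ (C : Ctx) {c : Fm} where

  private
    infer-left : ∀ D {r} → r ∈ leftRules c (C at D) → All Der (premises r) → C [ D ] ⊢ᶜ c
    infer-left D {r} r∈ = infer r (∈-++⁺ˡ (∈-concatMap⁺ (leftRules c) (lose (foci-complete C D) r∈)))

    logical : ∀ D {r} → r ∈ leftLogical C D c → All Der (premises r) → C [ D ] ⊢ᶜ c
    logical D r∈ = infer-left D (there (∈-++⁺ˡ r∈))

  ⊥Rᶜ : ∀ {D} → D ⊢ᶜ ⊥′ → C [ D ] ⊢ᶜ c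
  ⊥Rᶜ {D} d = infer-left D (here refl) (d ∷ [])

  ·Lᶜ : ∀ {a b} → C [ fm a ,, fm b ] ⊢ᶜ c → C [ fm (a ·′ b) ] ⊢ᶜ c
  ·Lᶜ d = logical _ (here refl) (d ∷ [])

  *Lᶜ : ∀ {a b} → C [ fm a ⨾ fm b ] ⊢ᶜ c → C [ fm (a *′ b) ] ⊢ᶜ c
  *Lᶜ d = logical _ (here refl) (d ∷ [])

  ∧L₁ᶜ : ∀ {a b} → C [ fm a ] ⊢ᶜ c → C [ fm (a ∧′ b) ] ⊢ᶜ c
  ∧L₁ᶜ d = logical _ (here refl) (d ∷ [])

  ∧L₂ᶜ : ∀ {a b} → C [ fm b ] ⊢ᶜ c → C [ fm (a ∧′ b) ] ⊢ᶜ c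
  ∧L₂ᶜ d = logical _ (there (here refl)) (d ∷ [])

  ∨Lᶜ : ∀ {a b} → C [ fm a ] ⊢ᶜ c → C [ fm b ] ⊢ᶜ c → C [ fm (a ∨′ b) ] ⊢ᶜ c
  ∨Lᶜ d e = logical _ (here refl) (d ∷ e ∷ [])

  ＼Lᶜ : ∀ {D a b} → D ⊢ᶜ a → C [ fm b ] ⊢ᶜ c → C [ D ,, fm (a \′ b) ] ⊢ᶜ c
  ＼Lᶜ d e = logical _ (here refl) (d ∷ e ∷ [])

  ⇒Lᶜ : ∀ {D a b} → D ⊢ᶜ a → C [ fm b ] ⊢ᶜ c → C [ D ⨾ fm (a ⇒′ b) ] ⊢ᶜ c
  ⇒Lᶜ d e = logical _ (here refl) (d ∷ e ∷ [])

  Exᶜ : ∀ {D E} → C [ D ,, E ] ⊢ᶜ c → C [ E ,, D ] ⊢ᶜ c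
  Exᶜ {D} {E} d = infer-left (E ,, D)
    (there (∈-++⁺ʳ (leftLogical C (E ,, D) c) (here refl))) (d ∷ [])

  Ex⨾ᶜ : ∀ {D E} → C [ D ⨾ E ] ⊢ᶜ c → C [ E ⨾ D ] ⊢ᶜ c
  Ex⨾ᶜ {D} {E} d = infer-left (E ⨾ D)
    (there (∈-++⁺ʳ (leftLogical C (E ⨾ D) c) (here refl))) (d ∷ [])

  As₁ᶜ : ∀ {D₁ D₂ D₃} → C [ D₁ ,, (D₂ ,, D₃) ] ⊢ᶜ c → C [ (D₁ ,, D₂) ,, D₃ ] ⊢ᶜ c
  As₁ᶜ {D₁} {D₂} {D₃} d = infer-left D
    (there (∈-++⁺ʳ (leftLogical C D c) (∈-++⁺ʳ (exchange C D c) (here refl)))) (d ∷ [])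
    where D = (D₁ ,, D₂) ,, D₃

  As₂ᶜ : ∀ {D₁ D₂ D₃} → C [ (D₁ ,, D₂) ,, D₃ ] ⊢ᶜ c → C [ D₁ ,, (D₂ ,, D₃) ] ⊢ᶜ c
  As₂ᶜ {D₁} {D₂} {D₃} d = infer-left D
    (there (∈-++⁺ʳ (leftLogical C D c) (∈-++⁺ʳ (exchange C D c)
      (∈-++⁺ʳ (associate₁ C D c) (here refl))))) (d ∷ [])
    where D = D₁ ,, (D₂ ,, D₃)

private
  infer-right : ∀ c G {r} → r ∈ rightLogical c G → All Der (premises r) → G ⊢ᶜ c
  infer-right c G {r} r∈ = infer r (∈-++⁺ʳ (concatMap (leftRules c) (foci G)) (∈-++⁺ˡ r∈))

  -- `identity a (fm a)` is stuck on the test `a ≟ a`. Naming the list `rs` lets a match on the test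
  -- unblock it.
  identity-infer : ∀ a {rs} → rs ≡ identity a (fm a) → Σ[ r ∈ Rule (fm a , a) ] r ∈ rs × premises r ≡ []
  identity-infer a eq with a ≟ a
  identity-infer a refl | yes refl = _ , here refl , refl
  identity-infer a _    | no a≢a   = contradiction refl a≢a

Idᶜ : ∀ {a} → fm a ⊢ᶜ a
Idᶜ {a} with identity-infer a refl
... | r , r∈ , eq = infer r
  (∈-++⁺ʳ (concatMap (leftRules a) (foci (fm a)))
    (∈-++⁺ʳ (rightLogical a (fm a)) (∈-++⁺ʳ (rotation a (fm a)) r∈)))
  (subst (All Der) (sym eq) [])

·Rᶜ : ∀ {G D a b} → G ⊢ᶜ a → D ⊢ᶜ b → G ,, D ⊢ᶜ a ·′ b
·Rᶜ d e = infer-right _ _ (here refl) (d ∷ e ∷ [])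

*Rᶜ : ∀ {G D a b} → G ⊢ᶜ a → D ⊢ᶜ b → G ⨾ D ⊢ᶜ a *′ b
*Rᶜ d e = infer-right _ _ (here refl) (d ∷ e ∷ [])

＼Rᶜ : ∀ {G a b} → fm a ,, G ⊢ᶜ b → G ⊢ᶜ a \′ b
＼Rᶜ d = infer-right _ _ (here refl) (d ∷ [])

⇒Rᶜ : ∀ {G a b} → fm a ⨾ G ⊢ᶜ b → G ⊢ᶜ a ⇒′ b
⇒Rᶜ d = infer-right _ _ (here refl) (d ∷ [])

∧Rᶜ : ∀ {G a b} → G ⊢ᶜ a → G ⊢ᶜ b → G ⊢ᶜ a ∧′ b
∧Rᶜ d e = infer-right _ _ (here refl) (d ∷ e ∷ [])

∨R₁ᶜ : ∀ {G a b} → G ⊢ᶜ a → G ⊢ᶜ a ∨′ b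
∨R₁ᶜ d = infer-right _ _ (here refl) (d ∷ [])

∨R₂ᶜ : ∀ {G a b} → G ⊢ᶜ b → G ⊢ᶜ a ∨′ b
∨R₂ᶜ d = infer-right _ _ (there (here refl)) (d ∷ [])

R-⊥ᶜ : ∀ {D₁ D₂ D₃} → (D₁ ,, D₂) ⨾ D₃ ⊢ᶜ ⊥′ → (D₁ ,, D₃) ⨾ D₂ ⊢ᶜ ⊥′
R-⊥ᶜ {D₁} {D₂} {D₃} d = infer _
  (∈-++⁺ʳ (concatMap (leftRules ⊥′) (foci G)) (∈-++⁺ʳ (rightLogical ⊥′ G) (here refl))) (d ∷ [])
  where G = (D₁ ,, D₃) ⨾ D₂

-- Semantic cut elimination

-- The biorthogonal closure, with pairs of a context and a succedent as tests.
cl : Pred Str 0ℓ → Pred Str 0ℓ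
cl P x = ∀ C c → (∀ {y} → P y → C [ y ] ⊢ᶜ c) → C [ x ] ⊢ᶜ c

cl-⊇ : ∀ {P} → P ⊆ cl P
cl-⊇ p C c k = k p

_⊚_ : Ctx → Ctx → Ctx
hole     ⊚ E = E
(C ,ˡ S) ⊚ E = (C ⊚ E) ,ˡ S
(S ,ʳ C) ⊚ E = S ,ʳ (C ⊚ E)
(C ⨾ˡ S) ⊚ E = (C ⊚ E) ⨾ˡ S
(S ⨾ʳ C) ⊚ E = S ⨾ʳ (C ⊚ E)

plug-⊚ : ∀ C E D → (C ⊚ E) [ D ] ≡ C [ E [ D ] ]
plug-⊚ hole     E D = refl
plug-⊚ (C ,ˡ S) E D = cong (_,, S) (plug-⊚ C E D)
plug-⊚ (S ,ʳ C) E D = cong (S ,,_) (plug-⊚ C E D)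
plug-⊚ (C ⨾ˡ S) E D = cong (_⨾ S) (plug-⊚ C E D)
plug-⊚ (S ⨾ʳ C) E D = cong (S ⨾_) (plug-⊚ C E D)

-- A test `C` of `E [ x ]` is the test `C ⊚ E` of `x`. This makes `cl` compatible with both
-- structural connectives.
cl-plug : ∀ E {P Q : Pred Str 0ℓ} → (∀ {y} → P y → Q (E [ y ])) → ∀ {x} → cl P x → cl Q (E [ x ])
cl-plug E P⇒Q {x} x∈ C c k = subst (_⊢ᶜ c) (plug-⊚ C E x)
  (x∈ (C ⊚ E) c λ {y} y∈ → subst (_⊢ᶜ c) (sym (plug-⊚ C E y)) (k (P⇒Q y∈)))

data Comma (P Q : Pred Str 0ℓ) : Pred Str 0ℓ where
  _,,_ : ∀ {x y} → P x → Q y → Comma P Q (x ,, y)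

data Semicolon (P Q : Pred Str 0ℓ) : Pred Str 0ℓ where
  _⨾_ : ∀ {x y} → P x → Q y → Semicolon P Q (x ⨾ y)

infix 4 _⊩_

-- Products and joins are closed off explicitly. The remaining clauses already yield closed sets, as
-- `closed` verifies.
_⊩_ : Str → Fm → Set
x ⊩ var p    = x ⊢ᶜ var p
x ⊩ ⊥′       = x ⊢ᶜ ⊥′
x ⊩ (a ·′ b) = cl (Comma (_⊩ a) (_⊩ b)) x
x ⊩ (a \′ b) = ∀ {y} → y ⊩ a → (y ,, x) ⊩ b
x ⊩ (a ∧′ b) = x ⊩ a × x ⊩ b
x ⊩ (a ∨′ b) = cl ((_⊩ a) ∪ (_⊩ b)) x
x ⊩ (a *′ b) = cl (Semicolon (_⊩ a) (_⊩ b)) x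
x ⊩ (a ⇒′ b) = ∀ {y} → y ⊩ a → (y ⨾ x) ⊩ b

closed : ∀ a {x} → cl (_⊩ a) x → x ⊩ a
closed (var p)  h = h hole (var p) (λ d → d)
closed ⊥′       h = h hole ⊥′ (λ d → d)
closed (a ·′ b) h = λ C c k → h C c (λ y⊩ → y⊩ C c k)
closed (a \′ b) h {y} y⊩ = closed b (cl-plug (y ,ʳ hole) (λ z⊩ → z⊩ y⊩) h)
closed (a ∧′ b) h = closed a (cl-plug hole proj₁ h) , closed b (cl-plug hole proj₂ h)
closed (a ∨′ b) h = λ C c k → h C c (λ y⊩ → y⊩ C c k)
closed (a *′ b) h = λ C c k → h C c (λ y⊩ → y⊩ C c k)
closed (a ⇒′ b) h {y} y⊩ = closed b (cl-plug (y ⨾ʳ hole) (λ z⊩ → z⊩ y⊩) h)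

mutual
  -- Okada's argument: left rules give `⊩-self`, right rules give `⊩⇒⊢ᶜ`. The implications are
  -- contravariant in their antecedent, so each half calls the other there.
  ⊩-self : ∀ a → fm a ⊩ a
  ⊩-self (var p)  = Idᶜ
  ⊩-self ⊥′       = Idᶜ
  ⊩-self (a ·′ b) = λ C c k → ·Lᶜ C (k (⊩-self a ,, ⊩-self b))
  ⊩-self (a \′ b) = λ y⊩ → closed b λ C c k → ＼Lᶜ C (⊩⇒⊢ᶜ a y⊩) (k (⊩-self b))
  ⊩-self (a ∧′ b) = closed a (λ C c k → ∧L₁ᶜ C (k (⊩-self a))) , closed b (λ C c k → ∧L₂ᶜ C (k (⊩-self b)))
  ⊩-self (a ∨′ b) = λ C c k → ∨Lᶜ C (k (inj₁ (⊩-self a))) (k (inj₂ (⊩-self b)))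
  ⊩-self (a *′ b) = λ C c k → *Lᶜ C (k (⊩-self a ⨾ ⊩-self b))
  ⊩-self (a ⇒′ b) = λ y⊩ → closed b λ C c k → ⇒Lᶜ C (⊩⇒⊢ᶜ a y⊩) (k (⊩-self b))

  ⊩⇒⊢ᶜ : ∀ a {x} → x ⊩ a → x ⊢ᶜ a
  ⊩⇒⊢ᶜ (var p)  d = d
  ⊩⇒⊢ᶜ ⊥′       d = d
  ⊩⇒⊢ᶜ (a ·′ b) h = h hole (a ·′ b) λ { (p ,, q) → ·Rᶜ (⊩⇒⊢ᶜ a p) (⊩⇒⊢ᶜ b q) }
  ⊩⇒⊢ᶜ (a \′ b) h = ＼Rᶜ (⊩⇒⊢ᶜ b (h (⊩-self a)))
  ⊩⇒⊢ᶜ (a ∧′ b) (p , q) = ∧Rᶜ (⊩⇒⊢ᶜ a p) (⊩⇒⊢ᶜ b q)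
  ⊩⇒⊢ᶜ (a ∨′ b) h = h hole (a ∨′ b) λ { (inj₁ p) → ∨R₁ᶜ (⊩⇒⊢ᶜ a p) ; (inj₂ q) → ∨R₂ᶜ (⊩⇒⊢ᶜ b q) }
  ⊩⇒⊢ᶜ (a *′ b) h = h hole (a *′ b) λ { (p ⨾ q) → *Rᶜ (⊩⇒⊢ᶜ a p) (⊩⇒⊢ᶜ b q) }
  ⊩⇒⊢ᶜ (a ⇒′ b) h = ⇒Rᶜ (⊩⇒⊢ᶜ b (h (⊩-self a)))

-- No closure is taken at the structural connectives, so members can be taken apart by pattern
-- matching.
⟪_⟫ : Str → Pred Str 0ℓ
⟪ fm a ⟫   = _⊩ a
⟪ G ,, D ⟫ = Comma ⟪ G ⟫ ⟪ D ⟫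
⟪ G ⨾ D ⟫  = Semicolon ⟪ G ⟫ ⟪ D ⟫

⟪⟫-self : ∀ G → ⟪ G ⟫ G
⟪⟫-self (fm a)   = ⊩-self a
⟪⟫-self (G ,, D) = ⟪⟫-self G ,, ⟪⟫-self D
⟪⟫-self (G ⨾ D)  = ⟪⟫-self G ⨾ ⟪⟫-self D

-- `E` is a semantic instance of `C`. The last field allows its hole to be refilled with an instance
-- of any other structure.
data Split (C : Ctx) (D : Str) : Pred Str 0ℓ where
  split : ∀ E {y} → ⟪ D ⟫ y → (∀ {D′ y′} → ⟪ D′ ⟫ y′ → ⟪ C [ D′ ] ⟫ (E [ y′ ])) → Split C D (E [ y ])

split-plug : ∀ C {D z} → ⟪ C [ D ] ⟫ z → Split C D z
split-plug hole z∈ = split hole z∈ (λ y∈ → y∈)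
split-plug (C ,ˡ S) (p ,, q) with split-plug C p
... | split E y∈ fill = split (E ,ˡ _) y∈ (λ y∈ → fill y∈ ,, q)
split-plug (S ,ʳ C) (q ,, p) with split-plug C p
... | split E y∈ fill = split (_ ,ʳ E) y∈ (λ y∈ → q ,, fill y∈)
split-plug (C ⨾ˡ S) (p ⨾ q) with split-plug C p
... | split E y∈ fill = split (E ⨾ˡ _) y∈ (λ y∈ → fill y∈ ⨾ q)
split-plug (S ⨾ʳ C) (q ⨾ p) with split-plug C p
... | split E y∈ fill = split (_ ⨾ʳ E) y∈ (λ y∈ → q ⨾ fill y∈)

infix 4 _⊨_

_⊨_ : Str → Fm → Set
G ⊨ a = ⟪ G ⟫ ⊆ (_⊩ a)

-- By `cl-plug` it suffices to treat generators from `P`, and each may choose its own `E`: two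
-- choices arise for `∨L`, none for `⊥R`.
⊨-covered : ∀ C {D c} (P : Pred Str 0ℓ) → ⟪ D ⟫ ⊆ cl P →
  (∀ {y} → P y → ∃[ E ] ⟪ E ⟫ y × C [ E ] ⊨ c) → C [ D ] ⊨ c
⊨-covered C {c = c} P D⊆P k z∈ with split-plug C z∈
... | split E y∈ fill = closed c
  (cl-plug E (λ y′∈P → let _ , y′∈ , h = k y′∈P in h (fill y′∈)) (D⊆P y∈))

⊨-replace : ∀ C {D E c} → ⟪ D ⟫ ⊆ cl ⟪ E ⟫ → C [ E ] ⊨ c → C [ D ] ⊨ c
⊨-replace C D⊆E h = ⊨-covered C _ D⊆E (λ y∈ → _ , y∈ , h)

⊢⇒⊨ : ∀ {G a} → G ⊢ a → G ⊨ a
⊢⇒⊨ Id z∈ = z∈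
⊢⇒⊨ (·L {C} p) = ⊨-replace C {E = _ ,, _} (λ y∈ → y∈) (⊢⇒⊨ p)
⊢⇒⊨ (·R p q) (x∈ ,, y∈) = cl-⊇ (⊢⇒⊨ p x∈ ,, ⊢⇒⊨ q y∈)
⊢⇒⊨ (*L {C} p) = ⊨-replace C {E = _ ⨾ _} (λ y∈ → y∈) (⊢⇒⊨ p)
⊢⇒⊨ (*R p q) (x∈ ⨾ y∈) = cl-⊇ (⊢⇒⊨ p x∈ ⨾ ⊢⇒⊨ q y∈)
⊢⇒⊨ (＼L {D} {C} {a} {b} p q) = ⊨-replace C {D ,, fm (a \′ b)} {fm b} (λ { (x∈ ,, y∈) → cl-⊇ (y∈ (⊢⇒⊨ p x∈)) }) (⊢⇒⊨ q)
⊢⇒⊨ (＼R p) z∈ x∈ = ⊢⇒⊨ p (x∈ ,, z∈)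
⊢⇒⊨ (⇒L {D} {C} {a} {b} p q) = ⊨-replace C {D ⨾ fm (a ⇒′ b)} {fm b} (λ { (x∈ ⨾ y∈) → cl-⊇ (y∈ (⊢⇒⊨ p x∈)) }) (⊢⇒⊨ q)
⊢⇒⊨ (⇒R p) z∈ x∈ = ⊢⇒⊨ p (x∈ ⨾ z∈)
⊢⇒⊨ (∧L₁ {C} {a} {c = c} p) = ⊨-replace C {fm (a ∧′ c)} {fm a} (λ y∈ → cl-⊇ (proj₁ y∈)) (⊢⇒⊨ p)
⊢⇒⊨ (∧L₂ {C} {a} {c = c} p) = ⊨-replace C {fm (c ∧′ a)} {fm a} (λ y∈ → cl-⊇ (proj₂ y∈)) (⊢⇒⊨ p)
⊢⇒⊨ (∧R p q) z∈ = ⊢⇒⊨ p z∈ , ⊢⇒⊨ q z∈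
⊢⇒⊨ (∨L {C} {a} {b} p q) = ⊨-covered C {fm (a ∨′ b)} _ (λ y∈ → y∈)
  λ { (inj₁ y∈) → fm a , y∈ , ⊢⇒⊨ p ; (inj₂ y∈) → fm b , y∈ , ⊢⇒⊨ q }
⊢⇒⊨ (∨R₁ p) z∈ = cl-⊇ (inj₁ (⊢⇒⊨ p z∈))
⊢⇒⊨ (∨R₂ p) z∈ = cl-⊇ (inj₂ (⊢⇒⊨ p z∈))
-- A structure deriving `⊥′` passes every test, so it lies in the closure of the empty set.
⊢⇒⊨ (⊥R {C} p) = ⊨-covered C (λ _ → ⊥) (λ y∈ C c _ → ⊥Rᶜ C (⊢⇒⊨ p y∈)) λ ()
⊢⇒⊨ (Cut {C} p q) = ⊨-replace C (λ y∈ → cl-⊇ (⊢⇒⊨ p y∈)) (⊢⇒⊨ q)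
-- At `⊥′` the semantics is cut-free derivability itself, so the syntactic rule applies directly.
⊢⇒⊨ (R-⊥ p) ((x∈ ,, z∈) ⨾ y∈) = R-⊥ᶜ (⊢⇒⊨ p ((x∈ ,, y∈) ⨾ z∈))
⊢⇒⊨ (Ex {C} {D} {E} p) = ⊨-replace C {E ,, D} {D ,, E}
  (λ { (x∈ ,, y∈) C c k → Exᶜ C (k (y∈ ,, x∈)) }) (⊢⇒⊨ p)
⊢⇒⊨ (Ex⨾ {C} {D} {E} p) = ⊨-replace C {E ⨾ D} {D ⨾ E}
  (λ { (x∈ ⨾ y∈) C c k → Ex⨾ᶜ C (k (y∈ ⨾ x∈)) }) (⊢⇒⊨ p)
⊢⇒⊨ (As₁ {C} {D₁} {D₂} {D₃} p) = ⊨-replace C {(D₁ ,, D₂) ,, D₃} {D₁ ,, (D₂ ,, D₃)}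
  (λ { ((x∈ ,, y∈) ,, z∈) C c k → As₁ᶜ C (k (x∈ ,, (y∈ ,, z∈))) }) (⊢⇒⊨ p)
⊢⇒⊨ (As₂ {C} {D₁} {D₂} {D₃} p) = ⊨-replace C {D₁ ,, (D₂ ,, D₃)} {(D₁ ,, D₂) ,, D₃}
  (λ { (x∈ ,, (y∈ ,, z∈)) C c k → As₂ᶜ C (k ((x∈ ,, y∈) ,, z∈)) }) (⊢⇒⊨ p)

-- `G` is an instance of itself, so soundness makes it force `a`, and forcing yields a cut-free
-- derivation.
cut-elimination : ∀ {G a} → G ⊢ a → G ⊢ᶜ a
cut-elimination {G} {a} p = ⊩⇒⊢ᶜ a (⊢⇒⊨ p (⟪⟫-self G))

-- Decidability

connectives : List (Fm → Fm → Fm)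
connectives = _·′_ ∷ _\′_ ∷ _∧′_ ∷ _∨′_ ∷ _*′_ ∷ _⇒′_ ∷ []

compounds : List Fm → List Fm
compounds as = concatMap (λ _∙_ → cartesianProductWith _∙_ as as) connectives

formulas : ℕ → List Fm
formulas zero    = []
formulas (suc n) = formulas n ++ var n ∷ ⊥′ ∷ compounds (formulas n)

-- The enumeration grows only at its end, so a search for the first match finds the same formula at
-- every later stage.
formulas-prefix : ∀ m n → ∃[ as ] formulas (n + m) ≡ formulas m ++ as
formulas-prefix m zero    = [] , sym (++-identityʳ (formulas m))
formulas-prefix m (suc n) with formulas-prefix m n
... | as , eq = as ++ new , trans (cong (_++ new) eq) (++-assoc (formulas m) as new)
  where new = var (n + m) ∷ ⊥′ ∷ compounds (formulas (n + m))

formulas-mono : ∀ {m n} → m ≤ n → ∀ {a} → a ∈ formulas m → a ∈ formulas n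
formulas-mono {m} m≤n {a} a∈ with ℕ.m≤n⇒∃[o]m+o≡n m≤n
... | o , refl = subst (λ k → a ∈ formulas k) (ℕ.+-comm o m)
  (subst (a ∈_) (sym (proj₂ (formulas-prefix m o))) (∈-++⁺ˡ a∈))

formulas-complete : ∀ a → a ∈ formulas ∣ a ∣
formulas-complete′ : ∀ {_∙_} → _∙_ ∈ connectives → ∀ a b → (a ∙ b) ∈ formulas (suc (∣ a ∣ + ∣ b ∣))

formulas-complete (var p)  = ∈-++⁺ʳ (formulas p) (here refl)
formulas-complete ⊥′       = there (here refl)
formulas-complete (a ·′ b) = formulas-complete′ (here refl) a b
formulas-complete (a \′ b) = formulas-complete′ (there (here refl)) a b
formulas-complete (a ∧′ b) = formulas-complete′ (there (there (here refl))) a b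
formulas-complete (a ∨′ b) = formulas-complete′ (there (there (there (here refl)))) a b
formulas-complete (a *′ b) = formulas-complete′ (there (there (there (there (here refl))))) a b
formulas-complete (a ⇒′ b) = formulas-complete′ (there (there (there (there (there (here refl)))))) a b

formulas-complete′ {_∙_} ∙∈ a b = ∈-++⁺ʳ (formulas n) (there (there
  (∈-concatMap⁺ (λ _∘_ → cartesianProductWith _∘_ (formulas n) (formulas n))
    (lose ∙∈ (∈-cartesianProductWith⁺ _∙_
      (formulas-mono (ℕ.m≤m+n ∣ a ∣ ∣ b ∣) (formulas-complete a))
      (formulas-mono (ℕ.m≤n+m ∣ b ∣ ∣ a ∣) (formulas-complete b)))))))
  where n = ∣ a ∣ + ∣ b ∣

-- The leaves use stage `suc n` of the formulas because `fm` adds nothing to the size.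
structures : ℕ → List Str
structures zero    = []
structures (suc n) = structures n ++ map fm (formulas (suc n)) ++
  cartesianProductWith _,,_ (structures n) (structures n) ++
  cartesianProductWith _⨾_ (structures n) (structures n)

structures-mono : ∀ {m n} → m ≤ n → ∀ {G} → G ∈ structures m → G ∈ structures n
structures-mono m≤n = go (ℕ.≤⇒≤′ m≤n)
  where
  go : ∀ {m n} → m ≤′ n → ∀ {G} → G ∈ structures m → G ∈ structures n
  go ≤′-refl       G∈ = G∈
  go (≤′-step m≤n) G∈ = ∈-++⁺ˡ (go m≤n G∈)

structures-fm : ∀ n {a} → a ∈ formulas n → fm a ∈ structures n
structures-fm (suc n) a∈ = ∈-++⁺ʳ (structures n) (∈-++⁺ˡ (∈-map⁺ fm a∈))

structures-complete : ∀ G → G ∈ structures ∣ G ∣ˢ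
structures-complete (fm a)   = structures-fm ∣ a ∣ (formulas-complete a)
structures-complete (G ,, D) =
  ∈-++⁺ʳ (structures n) (∈-++⁺ʳ (map fm (formulas (suc n))) (∈-++⁺ˡ
    (∈-cartesianProductWith⁺ _,,_
      (structures-mono (ℕ.m≤m+n ∣ G ∣ˢ ∣ D ∣ˢ) (structures-complete G))
      (structures-mono (ℕ.m≤n+m ∣ D ∣ˢ ∣ G ∣ˢ) (structures-complete D)))))
  where n = ∣ G ∣ˢ + ∣ D ∣ˢ
structures-complete (G ⨾ D)  =
  ∈-++⁺ʳ (structures n) (∈-++⁺ʳ (map fm (formulas (suc n)))
    (∈-++⁺ʳ (cartesianProductWith _,,_ (structures n) (structures n))
      (∈-cartesianProductWith⁺ _⨾_
        (structures-mono (ℕ.m≤m+n ∣ G ∣ˢ ∣ D ∣ˢ) (structures-complete G))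
        (structures-mono (ℕ.m≤n+m ∣ D ∣ˢ ∣ G ∣ˢ) (structures-complete D)))))
  where n = ∣ G ∣ˢ + ∣ D ∣ˢ

sequents : ℕ → List Seq
sequents n = cartesianProduct (structures n) (formulas n)

sequents-complete : ∀ {n} s → size s ≤ n → s ∈ sequents n
sequents-complete (G , a) h = ∈-cartesianProduct⁺
  (structures-mono (ℕ.m+n≤o⇒m≤o ∣ G ∣ˢ h) (structures-complete G))
  (formulas-mono (ℕ.m+n≤o⇒n≤o ∣ G ∣ˢ h) (formulas-complete a))

-- Saturation of a finite list of sequents

open DecMembership (Product.≡-dec _≟ˢ_ _≟_) using (_∈?_)

Applicable : List Seq → Pred Seq 0ℓ
Applicable X s = Any (λ r → All (_∈ X) (premises r)) (rules s)

applicable? : ∀ X → Decidable (Applicable X)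
applicable? X s = any? (λ r → all? (_∈? X) (premises r)) (rules s)

∈-─ : ∀ {A : Set} {P : Pred A 0ℓ} {xs x} (p : Any P xs) → x ∈ xs → x ≡ Any.lookup p ⊎ x ∈ (xs ─ p)
∈-─ (here _)  (here refl) = inj₁ refl
∈-─ (here _)  (there x∈)  = inj₂ x∈
∈-─ (there _) (here refl) = inj₂ (here refl)
∈-─ (there p) (there x∈)  with ∈-─ p x∈
... | inj₁ eq  = inj₁ eq
... | inj₂ x∈′ = inj₂ (there x∈′)

record Saturation (S : List Seq) : Set where
  field
    derived   : List Seq
    derivable : All Der derived
    saturated : ∀ {s} → s ∈ S → Applicable derived s → s ∈ derived

-- `go` keeps derived sequents in `X` and pending ones in `T`. Each round moves one pending sequent
-- with an applicable rule, so the length `n` of `T` drops. When none is left to move, `X` is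
-- saturated.
saturate : ∀ S → Saturation S
saturate S = go (length S) S [] refl [] inj₂
  where
  go : ∀ n T X → length T ≡ n → All Der X → (∀ {s} → s ∈ S → s ∈ X ⊎ s ∈ T) → Saturation S
  go n T X |T|≡n X-der S⊆X∪T with any? (applicable? X) T
  ... | no none = record
    { derived   = X
    ; derivable = X-der
    ; saturated = λ s∈S app → [ (λ s∈X → s∈X) , (λ s∈T → contradiction (lose s∈T app) none) ]′ (S⊆X∪T s∈S)
    }
  go zero    [] X _     _     _     | yes ()
  go (suc n) T  X |T|≡n X-der S⊆X∪T | yes p =
    go n (T ─ p) (Any.lookup p ∷ X)
      (ℕ.suc-injective (trans (sym (length-removeAt′ T (Any.index p))) |T|≡n))
      (derive (lookup-result p) ∷ X-der)
      λ s∈S → [ inj₁ ∘ there , (λ s∈T → Sum.map₁ here (∈-─ p s∈T)) ]′ (S⊆X∪T s∈S)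
    where
    derive : ∀ {s} → Applicable X s → Der s
    derive app with find app
    ... | r , r∈ , prems = infer r r∈ (All.map (All.lookup X-der) prems)

module _ (n : ℕ) where
  open Saturation (saturate (sequents n))

  mutual
    -- Premises never grow, so the whole derivation stays inside `sequents n`, and saturation
    -- collects it from the leaves down.
    Der⇒derived : ∀ {s} → size s ≤ n → Der s → s ∈ derived
    Der⇒derived {s} s≤n (infer r r∈ ds) = saturated (sequents-complete s s≤n)
      (lose r∈ (Ders⇒derived (All.map (λ t≤s → ℕ.≤-trans t≤s s≤n) (nonincreasing r)) ds))

    Ders⇒derived : ∀ {ss} → All (λ s → size s ≤ n) ss → All Der ss → All (_∈ derived) ss
    Ders⇒derived []        []       = []
    Ders⇒derived (h ∷ hs) (d ∷ ds) = Der⇒derived h d ∷ Ders⇒derived hs ds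

Der? : Decidable Der
Der? s = map′ (All.lookup derivable) (Der⇒derived (size s) ℕ.≤-refl) (s ∈? derived)
  where open Saturation (saturate (sequents (size s)))

-- Kept abstract so that the type checker never runs the proof search.
abstract
  _⊢?_ : ∀ G a → Dec (G ⊢ a)
  G ⊢? a = map′ Der⇒Provable cut-elimination (Der? (G , a))

-- The Lindenbaum algebra on normal forms

infix 4 _≼_ _≈_

_≼_ : Fm → Fm → Set
a ≼ b = fm a ⊢ b

_≈_ : Fm → Fm → Set
a ≈ b = a ≼ b × b ≼ a

_≈?_ : ∀ a b → Dec (a ≈ b)
a ≈? b = (fm a ⊢? b) ×-dec (fm b ⊢? a)

≼-trans : ∀ {a b c} → a ≼ b → b ≼ c → a ≼ c
≼-trans = Cut {hole}

≈-refl : ∀ {a} → a ≈ a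
≈-refl = Id , Id

≈-sym : ∀ {a b} → a ≈ b → b ≈ a
≈-sym (p , q) = q , p

≈-trans : ∀ {a b c} → a ≈ b → b ≈ c → a ≈ c
≈-trans (p , q) (r , s) = ≼-trans p r , ≼-trans s q

-- Normal forms of formulas

first : ∀ {A : Set} {P : Pred A 0ℓ} → Decidable P → A → List A → A
first P? d []       = d
first P? d (x ∷ xs) with P? x
... | yes _ = x
... | no  _ = first P? d xs

module _ {A : Set} {P : Pred A 0ℓ} (P? : Decidable P) where

  first-satisfies : ∀ {d} xs → P d → P (first P? d xs)
  first-satisfies []       Pd = Pd
  first-satisfies (x ∷ xs) Pd with P? x
  ... | yes Px = Px
  ... | no  _  = first-satisfies xs Pd

  -- A match in `xs` ends the search before `ys` or a default is reached, so the two defaults may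
  -- differ.
  first-++ : ∀ {d d′ xs} ys → Any P xs → first P? d (xs ++ ys) ≡ first P? d′ xs
  first-++ {xs = x ∷ xs} ys Pxs with P? x
  first-++ ys _          | yes _  = refl
  first-++ ys (here Px)  | no ¬Px = contradiction Px ¬Px
  first-++ ys (there Pxs) | no _  = first-++ ys Pxs

  first-cong : ∀ {Q : Pred A 0ℓ} (Q? : Decidable Q) {d} → P ⊆ Q → Q ⊆ P → ∀ xs → first P? d xs ≡ first Q? d xs
  first-cong Q? P⊆Q Q⊆P []       = refl
  first-cong Q? P⊆Q Q⊆P (x ∷ xs) with P? x | Q? x
  ... | yes _  | yes _  = refl
  ... | yes Px | no ¬Qx = contradiction (P⊆Q Px) ¬Qx
  ... | no ¬Px | yes Qx = contradiction (Q⊆P Qx) ¬Px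
  ... | no _   | no _   = first-cong Q? P⊆Q Q⊆P xs

abstract
  nf : Fm → Fm
  nf a = first (a ≈?_) a (formulas ∣ a ∣)

  nf-≈ : ∀ a → a ≈ nf a
  nf-≈ a = first-satisfies (a ≈?_) (formulas ∣ a ∣) ≈-refl

  nf-stable : ∀ a n → nf a ≡ first (a ≈?_) ⊥′ (formulas (n + ∣ a ∣))
  nf-stable a n with formulas-prefix ∣ a ∣ n
  ... | as , eq = sym (trans (cong (first (a ≈?_) ⊥′) eq)
    (first-++ (a ≈?_) as (lose (formulas-complete a) ≈-refl)))

  -- Both searches are moved to the common stage `∣ b ∣ + ∣ a ∣` with the common default `⊥′`. There
  -- equivalent formulas accept the same candidates.
  nf-cong : ∀ {a b} → a ≈ b → nf a ≡ nf b
  nf-cong {a} {b} a≈b = trans (nf-stable a ∣ b ∣) (trans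
    (first-cong (a ≈?_) (b ≈?_) (≈-trans (≈-sym a≈b)) (≈-trans a≈b) (formulas (∣ b ∣ + ∣ a ∣)))
    (trans (cong (first (b ≈?_) ⊥′ ∘ formulas) (ℕ.+-comm ∣ b ∣ ∣ a ∣)) (sym (nf-stable b ∣ a ∣))))

module Lindenbaum (ℓ : Level) where

  -- The fixed points of `nf` stand in for the quotient by `≈`. They are placed in `Set ℓ` so that
  -- the algebra exists at every level.
  record Class : Set ℓ where
    constructor class
    field
      rep    : Fm
      normal : nf rep ≡ rep

  open Class

  ⟨_⟩ : Fm → Class
  ⟨ a ⟩ = class (nf a) (nf-cong (≈-sym (nf-≈ a)))

  infix 4 _⊑_

  _⊑_ : Class → Class → Set
  x ⊑ y = rep x ≼ rep y

  rep-injective : ∀ {x y} → rep x ≡ rep y → x ≡ y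
  rep-injective {class a p} {class .a q} refl = cong (class a) (uip p q)

  -- Interderivable representatives have equal normal forms by `nf-cong`, and each is its own normal
  -- form.
  ⊑-antisym : ∀ {x y} → x ⊑ y → y ⊑ x → x ≡ y
  ⊑-antisym {x} {y} p q = rep-injective
    (trans (sym (normal x)) (trans (nf-cong (p , q)) (normal y)))

  ⊑-reflexive : ∀ {x y} → x ≡ y → x ⊑ y
  ⊑-reflexive refl = Id

  -- With `⟨⟩≼`, absorbs the normalisation performed by every operation on classes.
  ≼⟨⟩ : ∀ {a b} → a ≼ b → a ≼ rep ⟨ b ⟩
  ≼⟨⟩ {b = b} p = ≼-trans p (proj₁ (nf-≈ b))

  ⟨⟩≼ : ∀ {a b} → a ≼ b → rep ⟨ a ⟩ ≼ b
  ⟨⟩≼ {a} p = ≼-trans (proj₂ (nf-≈ a)) p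

  ⟨⟩-cong : ∀ {a b} → a ≈ b → ⟨ a ⟩ ≡ ⟨ b ⟩
  ⟨⟩-cong a≈b = rep-injective (nf-cong a≈b)

  lift₂ : (Fm → Fm → Fm) → Class → Class → Class
  lift₂ _∙_ x y = ⟨ rep x ∙ rep y ⟩

  lattice : Lattice ℓ ℓ 0ℓ
  lattice = record
    { Carrier = Class ; _≈_ = _≡_ ; _≤_ = _⊑_ ; _∨_ = lift₂ _∨′_ ; _∧_ = lift₂ _∧′_
    ; isLattice = record
      { isPartialOrder = record
        { isPreorder = record { isEquivalence = isEquivalence ; reflexive = ⊑-reflexive ; trans = ≼-trans }
        ; antisym = ⊑-antisym
        }
      ; supremum = λ x y → ≼⟨⟩ (∨R₁ Id) , ≼⟨⟩ (∨R₂ Id) , λ z p q → ⟨⟩≼ (∨L {hole} p q)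
      ; infimum = λ x y → ⟨⟩≼ (∧L₁ {hole} Id) , ⟨⟩≼ (∧L₂ {hole} Id) , λ z p q → ≼⟨⟩ (∧R p q)
      }
    }

  private
    module L = Lattice lattice
    module J = JoinProperties L.joinSemilattice
    module M = MeetProperties L.meetSemilattice
    module LP = LatticeProperties lattice

  open L using (_∧_; _∨_)

  ⊑⇒∧≡ : ∀ {x} y → x ⊑ y → x ∧ y ≡ x
  ⊑⇒∧≡ {x} y p = trans (M.∧-comm x y) (M.y≤x⇒x∧y≈y {y} {x} p)

  ∧≡⇒⊑ : ∀ {x} y → x ∧ y ≡ x → x ⊑ y
  ∧≡⇒⊑ {x} y eq = subst (_⊑ y) eq (L.x∧y≤y x y)

  ·-mono : ∀ {a b c d} → a ≼ b → c ≼ d → a ·′ c ≼ b ·′ d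
  ·-mono p q = ·L {hole} (·R p q)

  *-mono : ∀ {a b c d} → a ≼ b → c ≼ d → a *′ c ≼ b *′ d
  *-mono p q = *L {hole} (*R p q)

  ·-comm : ∀ {a b} → a ·′ b ≼ b ·′ a
  ·-comm = ·L {hole} (Ex {hole} (·R Id Id))

  *-comm : ∀ {a b} → a *′ b ≼ b *′ a
  *-comm = *L {hole} (Ex⨾ {hole} (*R Id Id))

  ·-assocʳ : ∀ {a b c} → (a ·′ b) ·′ c ≼ a ·′ (b ·′ c)
  ·-assocʳ = ·L {hole} (·L {hole ,ˡ _} (As₁ {hole} (·R Id (·R Id Id))))

  ·-assocˡ : ∀ {a b c} → a ·′ (b ·′ c) ≼ (a ·′ b) ·′ c
  ·-assocˡ = ·L {hole} (·L {_ ,ʳ hole} (As₂ {hole} (·R (·R Id Id) Id)))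

  ＼-intro : ∀ {a b c} → a ·′ b ≼ c → b ≼ a \′ c
  ＼-intro p = ＼R (Cut {hole} (·R Id Id) p)

  ＼-elim : ∀ {a b c} → b ≼ a \′ c → a ·′ b ≼ c
  ＼-elim p = ·L {hole} (Cut {_ ,ʳ hole} p (＼L {G = hole} Id Id))

  ⇒-intro : ∀ {a b c} → a *′ b ≼ c → b ≼ a ⇒′ c
  ⇒-intro p = ⇒R (Cut {hole} (*R Id Id) p)

  ⇒-elim : ∀ {a b c} → b ≼ a ⇒′ c → a *′ b ≼ c
  ⇒-elim p = *L {hole} (Cut {_ ⨾ʳ hole} p (⇒L {G = hole} Id Id))

  -- The products are unpacked into structures, where `R-⊥` exchanges `b` and `c`.
  rotate : ∀ {a b c} → (a ·′ b) *′ c ≼ ⊥′ → (a ·′ c) *′ b ≼ ⊥′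
  rotate p = *L {hole} (·L {hole ⨾ˡ _} (R-⊥ (Cut {hole} (*R (·R Id Id) Id) p)))

  ⊥-least : ∀ {a} → ⊥′ ≼ a
  ⊥-least = ⊥R {hole} Id

  algebra : CbRL ℓ
  algebra = record
    { Carrier = Class
    ; _∧_ = _∧_
    ; _∨_ = _∨_
    ; _·_ = lift₂ _·′_
    ; _\\_ = lift₂ _\′_
    ; _*_ = lift₂ _*′_
    ; _⇒_ = lift₂ _⇒′_
    ; bot = ⟨ ⊥′ ⟩
    ; top = ⟨ ⊤′ ⟩
    ; ∧-assoc = M.∧-assoc
    ; ∨-assoc = J.∨-assoc
    ; ∧-comm = M.∧-comm
    ; ∨-comm = J.∨-comm
    ; ∧-absorb = LP.∧-absorbs-∨
    ; ∨-absorb = LP.∨-absorbs-∧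
    ; bot-least = λ a → ⊑⇒∧≡ a (⟨⟩≼ ⊥-least)
    -- `⊤′` unfolds to `⊥′ ⇒′ ⊥′`, so `⇒R` puts a `⊥′` on the left, which explodes.
    ; top-great = λ a → ⊑⇒∧≡ ⟨ ⊤′ ⟩ (≼⟨⟩ (⇒R (⊥R {hole ⨾ˡ _} Id)))
    ; ·-assoc = λ a b c → ⟨⟩-cong
        ( ≼-trans (·-mono (⟨⟩≼ Id) Id) (≼-trans ·-assocʳ (·-mono Id (≼⟨⟩ Id)))
        , ≼-trans (·-mono Id (⟨⟩≼ Id)) (≼-trans ·-assocˡ (·-mono (≼⟨⟩ Id) Id)))
    ; ·-comm = λ a b → ⟨⟩-cong (·-comm , ·-comm)
    ; ·-res₁ = λ a b c p → ⊑⇒∧≡ (lift₂ _\′_ a c) (≼⟨⟩ (＼-intro (≼-trans (≼⟨⟩ Id) (∧≡⇒⊑ c p))))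
    ; ·-res₂ = λ a b c p → ⊑⇒∧≡ c (⟨⟩≼ (＼-elim (≼-trans (∧≡⇒⊑ (lift₂ _\′_ a c) p) (⟨⟩≼ Id))))
    ; *-comm = λ a b → ⟨⟩-cong (*-comm , *-comm)
    ; *-res₁ = λ a b c p → ⊑⇒∧≡ (lift₂ _⇒′_ a c) (≼⟨⟩ (⇒-intro (≼-trans (≼⟨⟩ Id) (∧≡⇒⊑ c p))))
    ; *-res₂ = λ a b c p → ⊑⇒∧≡ c (⟨⟩≼ (⇒-elim (≼-trans (∧≡⇒⊑ (lift₂ _⇒′_ a c) p) (⟨⟩≼ Id))))
    -- The equation `p` gives a derivation of `⊥′` once normal forms are stripped. `rotate` carries
    -- it over, and the converse direction is `⊥-least`.
    ; ⊥-cond = λ a b c p → ⟨⟩-cong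
        ( ≼-trans (*-mono (⟨⟩≼ Id) Id)
            (rotate (≼-trans (*-mono (≼⟨⟩ Id) Id) (≼-trans (≼⟨⟩ Id) (≼-trans (⊑-reflexive p) (⟨⟩≼ Id)))))
        , ⊥-least)
    }

  -- Truth lemma and completeness

  valuation : ℕ → Class
  valuation p = ⟨ var p ⟩

  lift₂-⟨⟩ : ∀ {_∙_} → (∀ {a b c d} → a ≈ c → b ≈ d → (a ∙ b) ≈ (c ∙ d)) →
    ∀ a b → lift₂ _∙_ ⟨ a ⟩ ⟨ b ⟩ ≡ ⟨ a ∙ b ⟩
  lift₂-⟨⟩ ∙-cong a b = ⟨⟩-cong (∙-cong (≈-sym (nf-≈ a)) (≈-sym (nf-≈ b)))

  -- Every connective respects `≈`, so normalising its arguments first leaves the class unchanged.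
  truth : ∀ a → ⟦ algebra ⟧ valuation a ≡ ⟨ a ⟩
  truth (var p)  = refl
  truth ⊥′       = refl
  truth (a ·′ b) rewrite truth a | truth b =
    lift₂-⟨⟩ (λ { (p , q) (r , s) → ·-mono p r , ·-mono q s }) a b
  truth (a \′ b) rewrite truth a | truth b =
    -- The antecedent is contravariant, so its two derivations trade places.
    lift₂-⟨⟩ (λ { (p , q) (r , s) → ＼-mono q r , ＼-mono p s }) a b
    where
    ＼-mono : ∀ {a b c d} → b ≼ a → c ≼ d → a \′ c ≼ b \′ d
    ＼-mono p q = ＼R (＼L {G = hole} p q)
  truth (a ∧′ b) rewrite truth a | truth b =
    lift₂-⟨⟩ (λ { (p , q) (r , s) → ∧-mono p r , ∧-mono q s }) a b
    where
    ∧-mono : ∀ {a b c d} → a ≼ b → c ≼ d → a ∧′ c ≼ b ∧′ d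
    ∧-mono p q = ∧R (∧L₁ {hole} p) (∧L₂ {hole} q)
  truth (a ∨′ b) rewrite truth a | truth b =
    lift₂-⟨⟩ (λ { (p , q) (r , s) → ∨-mono p r , ∨-mono q s }) a b
    where
    ∨-mono : ∀ {a b c d} → a ≼ b → c ≼ d → a ∨′ c ≼ b ∨′ d
    ∨-mono p q = ∨L {hole} (∨R₁ p) (∨R₂ q)
  truth (a *′ b) rewrite truth a | truth b =
    lift₂-⟨⟩ (λ { (p , q) (r , s) → *-mono p r , *-mono q s }) a b
  truth (a ⇒′ b) rewrite truth a | truth b =
    lift₂-⟨⟩ (λ { (p , q) (r , s) → ⇒-mono q r , ⇒-mono p s }) a b
    where
    ⇒-mono : ∀ {a b c d} → b ≼ a → c ≼ d → a ⇒′ c ≼ b ⇒′ d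
    ⇒-mono p q = ⇒R (⇒L {G = hole} p q)

  ⊢-f : ∀ G → G ⊢ f G
  ⊢-f (fm a)   = Id
  ⊢-f (G ,, D) = ·R (⊢-f G) (⊢-f D)
  ⊢-f (G ⨾ D)  = *R (⊢-f G) (⊢-f D)

  complete : ∀ {G a} → Valid ℓ G a → G ⊢ a
  -- Validity in the Lindenbaum algebra relates the normal forms of `f G` and `a`. A cut on `f G`
  -- returns to the structure `G`.
  complete {G} {a} valid = Cut {hole} (⊢-f G) (≼-trans (≼⟨⟩ Id) (≼-trans ⟨fG⟩⊑⟨a⟩ (⟨⟩≼ Id)))
    where
    ⟨fG⟩⊑⟨a⟩ : ⟨ f G ⟩ ⊑ ⟨ a ⟩
    ⟨fG⟩⊑⟨a⟩ = subst₂ _⊑_ (truth (f G)) (truth a) (∧≡⇒⊑ (⟦ algebra ⟧ valuation a) (valid algebra valuation))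

theorem4 : (ℓ : Level) (G : Str) (a : Fm) → (G ⊢ a) ⇔ Valid ℓ G a
theorem4 ℓ G a = mk⇔ (λ d A μ → Soundness.sound A μ d) (Lindenbaum.complete ℓ)
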